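{- There is a randomised algorithm that, given the vertex set of a hidden connected $n$-vertex graph $G$ of maximum degree at most $\Delta$ and treelength at most $k$ together with access to a distance oracle for $G$, reconstructs $G$ using $O_{\Delta,k}(n \log^2 n)$ distance queries in expectation.
   Context: All graphs are simple, undirected and connected. In the distance query model, only the vertex set $V$ of a hidden graph $G=(V,E)$ is known; the algorithm may adaptively query an oracle which, given a pair $(u,v)\in V^2$, returns the shortest path distance $d_G(u,v)$. For a class $\mathcal{G}$ of connected graphs, an algorithm reconstructs the graphs in the class if for every $G\in\mathcal{G}$ the distance profile obtained from its queries is not compatible with any other graph in $\mathcal{G}$ (equivalently, it determines the edge set $E$). The query complexity of a randomised algorithm is the maximum over input graphs in the class of the expected number of queries (expectation over the algorithm's randomness). A tree decomposition of $G$ is a pair $(T,(B_t)_{t\in V(T)})$ where $T$ is a tree and $B_t\subseteq V(G)$, such that for every $v\in V(G)$ the set $\{t : v\in B_t\}$ is nonempty and induces a subtree of $T$, and every edge of $G$ is contained in some bag $B_t$. The treelength of $G$ is the minimum integer $k$ such that $G$ has a tree decomposition in which $d_G(u,v)\le k$ for all $u,v$ lying in a common bag (distances measured in the whole graph $G$). The notation $O_{\Delta,k}(f(n))$ means at most $g(\Delta,k)\,f(n)$ for some function $g$ depending only on $\Delta$ and $k$. -}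

module Defs where

open import Data.Nat using (ℕ; zero; suc; _≤_; _∸_; _<ᵇ_)
open import Data.Bool using (Bool; true; false; _∧_; T)
open import Data.Fin using (Fin; toℕ)
open import Data.List using (List; length; filterᵇ; cartesianProduct; allFin)
open import Data.Product using (Σ; _×_; _,_; ∃; proj₁; proj₂)
open import Data.Vec using (tabulate)
open import Data.Unit using (⊤)
open import Data.Integer using (+_)
open import Relation.Binary.PropositionalEquality using (_≡_)
open import Data.Rational.Unnormalised using (ℚᵘ; mkℚᵘ; 0ℚᵘ; 1ℚᵘ; _+_; _*_)
import Data.Vec as V

record Graph (n : ℕ) : Set where
  field
    adj   : Fin n → Fin n → Bool
    sym   : ∀ u v → adj u v ≡ adj v u
    irrefl : ∀ u → adj u u ≡ false
open Graph public

data WalkIn {n : ℕ} (G : Graph n) (S : Fin n → Set) : Fin n → Fin n → ℕ → Set where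
  nil  : ∀ {u} → S u → WalkIn G S u u 0
  cons : ∀ {u w v ℓ} → S u → adj G u w ≡ true → WalkIn G S w v ℓ → WalkIn G S u v (suc ℓ)

Everywhere : {n : ℕ} → Fin n → Set
Everywhere _ = ⊤

Walk : {n : ℕ} → Graph n → Fin n → Fin n → ℕ → Set
Walk G = WalkIn G Everywhere

Connected : {n : ℕ} → Graph n → Set
Connected G = ∀ u v → ∃ λ ℓ → Walk G u v ℓ

IsDistance : {n : ℕ} → Graph n → (Fin n → Fin n → ℕ) → Set
IsDistance G d = ∀ u v → Walk G u v (d u v) × (∀ ℓ → Walk G u v ℓ → d u v ≤ ℓ)

degree : {n : ℕ} → Graph n → Fin n → ℕ
degree {n} G v = length (filterᵇ (adj G v) (allFin n))

MaxDegreeAtMost : {n : ℕ} → ℕ → Graph n → Set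
MaxDegreeAtMost Δ G = ∀ v → degree G v ≤ Δ

numEdges : {n : ℕ} → Graph n → ℕ
numEdges {n} G =
  length (filterᵇ (λ p → adj G (proj₁ p) (proj₂ p) ∧ (toℕ (proj₁ p) <ᵇ toℕ (proj₂ p)))
                  (cartesianProduct (allFin n) (allFin n)))

IsTree : {m : ℕ} → Graph m → Set
IsTree {m} T = Connected T × numEdges T ≡ m ∸ 1

record TreeDecomposition {n : ℕ} (G : Graph n) : Set where
  field
    m       : ℕ
    tree    : Graph m
    isTree  : IsTree tree
    bag     : Fin m → Fin n → Bool
    covers  : ∀ v → ∃ λ t → T (bag t v)
    subtree : ∀ v t t' → T (bag t v) → T (bag t' v) →
              ∃ λ ℓ → WalkIn tree (λ s → T (bag s v)) t t' ℓ
    edges   : ∀ u v → adj G u v ≡ true → ∃ λ t → T (bag t u) × T (bag t v)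
open TreeDecomposition public

TreelengthAtMost : {n : ℕ} → ℕ → Graph n → Set
TreelengthAtMost k G =
  Σ (TreeDecomposition G) λ D →
    ∀ t u v → T (bag D t u) → T (bag D t v) → ∃ λ ℓ → ℓ ≤ k × Walk G u v ℓ

InClass : {n : ℕ} → ℕ → ℕ → Graph n → Set
InClass Δ k G = Connected G × MaxDegreeAtMost Δ G × TreelengthAtMost k G

SameEdges : {n : ℕ} → Graph n → Graph n → Set
SameEdges G G' = ∀ u v → adj G u v ≡ adj G' u v

-- Randomised adaptive distance-query algorithms on vertex set Fin n,
-- as well-founded decision trees:
--   query u v k : ask the oracle for d(u,v), continue with k (answer)
--   rand m k    : draw i ∈ Fin (suc m) uniformly at random, continue with k i
--   done        : stop

data Alg (n : ℕ) : Set where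
  done  : Alg n
  query : Fin n → Fin n → (ℕ → Alg n) → Alg n
  rand  : (m : ℕ) → (Fin (suc m) → Alg n) → Alg n

expectedQueries : {n : ℕ} → Alg n → (Fin n → Fin n → ℕ) → ℚᵘ
expectedQueries done d = 0ℚᵘ
expectedQueries (query u v k) d = 1ℚᵘ + expectedQueries (k (d u v)) d
expectedQueries (rand m k) d =
  mkℚᵘ (+ 1) m * V.foldr _ _+_ 0ℚᵘ (tabulate (λ i → expectedQueries (k i) d))

-- Along every run on oracle d, the answers obtained are incompatible with
-- every graph of the class (same vertex set) whose edge set differs from G's.
-- P accumulates the constraints "d'(u,v) = answer" from queries made so far.
ReconstructsFrom : {n : ℕ} → ℕ → ℕ → Graph n → (Fin n → Fin n → ℕ) →
                   ((Fin n → Fin n → ℕ) → Set) → Alg n → Set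
ReconstructsFrom {n} Δ k G d P done =
  ∀ (G' : Graph n) (d' : Fin n → Fin n → ℕ) →
    InClass Δ k G' → IsDistance G' d' → P d' → SameEdges G G'
ReconstructsFrom Δ k G d P (query u v c) =
  ReconstructsFrom Δ k G d (λ d' → P d' × d' u v ≡ d u v) (c (d u v))
ReconstructsFrom Δ k G d P (rand m c) =
  ∀ i → ReconstructsFrom Δ k G d P (c i)

Reconstructs : {n : ℕ} → ℕ → ℕ → Graph n → (Fin n → Fin n → ℕ) → Alg n → Set
Reconstructs Δ k G d A = ReconstructsFrom Δ k G d (λ _ → ⊤) A

{-# OPTIONS --safe #-}

-- The algorithm is deterministic.  Let h be the distance to a fixed root, and insert the
-- vertices in order of h.  A neighbour p of the new vertex u with h p + 1 = h u is found by
-- binary search: whether a vertex z lies on a geodesic from the root to u is decided by the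
-- query d(z,u), and the vertices below z are known already.  In a graph of treelength k, two
-- vertices of a layer {h = j} that are connected in {h ≥ j} are at distance at most 3k.  So if
-- all distances between such vertices are known for the earlier layers, every such vertex in
-- the layer of u, and every neighbour of u inserted before, is p′ or adjacent to p′ for some p′
-- at known distance at most 3k from p.  These are O_{Δ,k}(1) candidates, and u queries them all.
module Submission where

open import Defs
open import Data.Bool using (Bool; true; false; _∧_; T; if_then_else_)
import Data.Bool.Properties as Bool
open import Data.Bool.Properties using (T-≡; T-∧)
open import Data.Empty using (⊥)
open import Data.Fin using (Fin; zero; suc; toℕ; punchIn)
import Data.Fin.Properties as Fin
import Data.Integer as ℤ
import Data.Integer.Properties as ℤ
open import Data.List
  using (List; []; _∷_; _++_; length; map; allFin; cartesianProduct; filter; filterᵇ; concatMap)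
open import Data.List.Extrema.Nat using (argmax; f[⊥]≤f[argmax]; f[xs]≤f[argmax])
import Data.List.Membership.DecPropositional as DecMembership
open import Data.List.Membership.Propositional using (_∈_; _∉_)
open import Data.List.Membership.Propositional.Properties
  using (∈-∃++; ∈-++⁻; ∈-++⁺ˡ; ∈-++⁺ʳ; ∈-map⁻; ∈-filter⁺; ∈-filter⁻; ∈-allFin; ∈-length;
         ∈-cartesianProduct⁺; ∈-concatMap⁺)
open import Data.List.Properties
  using (length-map; length-tabulate; length-++; filter-all; length-filter)
open import Data.List.Relation.Binary.Permutation.Propositional using (_↭_; ↭-sym)
open import Data.List.Relation.Binary.Permutation.Propositional.Properties
  using (↭-length; ∈-resp-↭)
open import Data.List.Relation.Binary.Subset.Propositional using (_⊆_)
import Data.List.Relation.Unary.All as All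
import Data.List.Relation.Unary.All.Properties as All
open import Data.List.Relation.Unary.AllPairs using (AllPairs; []; _∷_)
import Data.List.Relation.Unary.Any as Any
open import Data.List.Relation.Unary.Any using (here; there)
open import Data.List.Relation.Unary.Sorted.TotalOrder.Properties using (Sorted⇒AllPairs)
open import Data.List.Relation.Unary.Unique.Propositional using (Unique)
import Data.List.Relation.Unary.Unique.Propositional.Properties as Unique
import Data.List.Sort as Sort
open import Data.Maybe using (Maybe; just; nothing; fromMaybe)
open import Data.Maybe.Properties using (just-injective)
open import Data.Nat
  using (ℕ; zero; suc; _*_; _^_; _+_; _≤_; _<_; z≤n; s≤s; s≤s⁻¹; _<ᵇ_; _≤?_; _<?_; _≟_)
open import Data.Nat.Logarithm using (⌈log₂_⌉; ⌈log₂⌉-mono-≤; ⌈log₂2^n⌉≡n)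
open import Data.Nat.Properties hiding (_≟_; _≤?_; _<?_)
open import Data.Product using (Σ; ∃; _×_; _,_; proj₁; proj₂)
open import Data.Product.Properties using (≡-dec)
open import Data.Rational.Unnormalised using (mkℚᵘ; *≤*) renaming (_≤_ to _≤ℚ_)
open import Data.Sum using (_⊎_; inj₁; inj₂)
open import Data.Unit using (tt)
open import Function using (_∘_)
open import Function.Bundles using (Equivalence)
open import Relation.Binary using (DecidableEquality; DecTotalOrder; tri<; tri≈; tri>)
import Relation.Binary.Construct.On as On
open import Relation.Binary.PropositionalEquality
  using (_≡_; _≢_; refl; trans; cong; cong₂; subst; subst₂) renaming (sym to ≡-sym)
open import Relation.Nullary using (¬_; Dec; yes; no; contradiction; ¬?; _×-dec_; _⊎-dec_)
open import Relation.Nullary.Decidable using (map′; T?; ⌊_⌋; toWitness; fromWitness)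

-- Walks and shortest-path distances.

module _ {n : ℕ} {G : Graph n} {S : Fin n → Set} where

  walk-source : ∀ {u v ℓ} → WalkIn G S u v ℓ → S u
  walk-source (nil su) = su
  walk-source (cons su _ _) = su

  walk-target : ∀ {u v ℓ} → WalkIn G S u v ℓ → S v
  walk-target (nil su) = su
  walk-target (cons _ _ p) = walk-target p

  walk-append : ∀ {u v w a b} → WalkIn G S u v a → WalkIn G S v w b → WalkIn G S u w (a + b)
  walk-append (nil _) q = q
  walk-append (cons su e p) q = cons su e (walk-append p q)

  walk-reverse : ∀ {u v ℓ} → WalkIn G S u v ℓ → WalkIn G S v u ℓ
  walk-reverse (nil su) = nil su
  walk-reverse {u} {v} (cons {w = w} {ℓ = ℓ} su e p) =
    subst (WalkIn G S v u) (+-comm ℓ 1)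
      (walk-append (walk-reverse p)
        (cons (walk-source p) (trans (sym G w u) e) (nil su)))

  walk-map : ∀ {S′ : Fin n → Set} {u v ℓ} → (∀ {x} → S x → S′ x) →
             WalkIn G S u v ℓ → WalkIn G S′ u v ℓ
  walk-map f (nil su) = nil (f su)
  walk-map f (cons su e p) = cons (f su) e (walk-map f p)

module _ {n : ℕ} (G : Graph n) where

  walk? : ∀ ℓ u v → Dec (Walk G u v ℓ)
  walk? zero u v = map′ (λ { refl → nil tt }) (λ { (nil _) → refl }) (u Fin.≟ v)
  walk? (suc ℓ) u v =
    map′ (λ { (w , e , p) → cons tt e p }) (λ { (cons _ e p) → _ , e , p })
         (Fin.any? (λ w → (adj G u w Bool.≟ true) ×-dec walk? ℓ w v))

least : {P : ℕ → Set} → (∀ i → Dec (P i)) → ∀ i → P i →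
        ∃ λ j → P j × (∀ i → P i → j ≤ i)
least P? i pi with P? 0
... | yes p0 = 0 , p0 , λ _ _ → z≤n
least P? zero pi | no ¬p0 = contradiction pi ¬p0
least P? (suc i) pi | no ¬p0 with least (P? ∘ suc) i pi
... | j , pj , j≤ = suc j , pj ,
      λ { zero p0 → contradiction p0 ¬p0 ; (suc k) pk → s≤s (j≤ k pk) }

-- Walks of a given length are decidable on a finite vertex set, so a least length can be searched
-- for. This supplies heights in a decomposition tree, which comes without a distance function.
distance-exists : ∀ {n} {G : Graph n} → Connected G → ∃ λ d → IsDistance G d
distance-exists {G = G} conn = (λ u v → proj₁ (L u v)) , λ u v → proj₂ (L u v)
  where
  L : ∀ u v → ∃ λ j → Walk G u v j × (∀ i → Walk G u v i → j ≤ i)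
  L u v = least (λ ℓ → walk? G ℓ u v) (proj₁ (conn u v)) (proj₂ (conn u v))

module Metric {n : ℕ} {G : Graph n} {d : Fin n → Fin n → ℕ} (D : IsDistance G d) where

  geodesic : ∀ u v → Walk G u v (d u v)
  geodesic u v = proj₁ (D u v)

  d-minimal : ∀ {u v ℓ} → Walk G u v ℓ → d u v ≤ ℓ
  d-minimal p = proj₂ (D _ _) _ p

  d-refl : ∀ u → d u u ≡ 0
  d-refl u = n≤0⇒n≡0 (d-minimal (nil tt))

  d-sym : ∀ u v → d u v ≡ d v u
  d-sym u v = ≤-antisym (d-minimal (walk-reverse (geodesic v u)))
                        (d-minimal (walk-reverse (geodesic u v)))

  d-triangle : ∀ u v w → d u w ≤ d u v + d v w
  d-triangle u v w = d-minimal (walk-append (geodesic u v) (geodesic v w))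

  d≡0⇒≡ : ∀ {u v} → d u v ≡ 0 → u ≡ v
  d≡0⇒≡ {u} {v} eq with d u v | geodesic u v
  ... | _ | nil _ = refl
  d≡0⇒≡ () | _ | cons _ _ _

  adj⇒d≤1 : ∀ {u v} → adj G u v ≡ true → d u v ≤ 1
  adj⇒d≤1 e = d-minimal (cons tt e (nil tt))

  adj⇒≢ : ∀ {u v} → adj G u v ≡ true → u ≢ v
  adj⇒≢ {u} e refl = contradiction (trans (≡-sym e) (irrefl G u)) λ ()

  adj-sym : ∀ {u v} → adj G u v ≡ true → adj G v u ≡ true
  adj-sym {u} {v} e = trans (sym G v u) e

  adj⇒d≡1 : ∀ {u v} → adj G u v ≡ true → d u v ≡ 1
  adj⇒d≡1 {u} {v} e with d u v in eq | adj⇒d≤1 e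
  ... | zero | _ = contradiction (d≡0⇒≡ eq) (adj⇒≢ e)
  ... | suc zero | _ = refl
  ... | suc (suc _) | s≤s ()

  first-step : ∀ {u v ℓ} → d u v ≡ suc ℓ → ∃ λ w → adj G u w ≡ true × d w v ≡ ℓ
  first-step {u} {v} {ℓ} eq with subst (Walk G u v) eq (geodesic u v)
  ... | cons {w = w} _ e p = w , e , ≤-antisym (d-minimal p)
        (s≤s⁻¹ (subst (_≤ suc (d w v)) eq (d-minimal (cons tt e (geodesic w v)))))

  d≡1⇒adj : ∀ {u v} → d u v ≡ 1 → adj G u v ≡ true
  d≡1⇒adj {u} eq with first-step eq
  ... | w , e , dw≡0 = subst (λ x → adj G u x ≡ true) (d≡0⇒≡ dw≡0) e

  -- Layers of the distance from a root.

  module Layers (r : Fin n) (h : Fin n → ℕ) (h-spec : ∀ v → h v ≡ d r v) where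

    -- Equality in the triangle inequality: `z` lies on a geodesic from `r` to `u`. Once `h` is
    -- known, the single answer `d z u` decides it.
    Above : Fin n → Fin n → Set
    Above z u = h z + d z u ≡ h u

    h-lipschitz : ∀ x y → h y ≤ h x + d x y
    h-lipschitz x y = subst₂ (λ a b → a ≤ b + d x y)
      (≡-sym (h-spec y)) (≡-sym (h-spec x)) (d-triangle r x y)

    h-root : h r ≡ 0
    h-root = trans (h-spec r) (d-refl r)

    h≡0⇒≡root : ∀ {x} → h x ≡ 0 → r ≡ x
    h≡0⇒≡root {x} eq = d≡0⇒≡ (trans (≡-sym (h-spec x)) eq)

    h-adj : ∀ {x y} → adj G x y ≡ true → h y ≤ suc (h x)
    h-adj {x} {y} e = subst (h y ≤_) (+-comm (h x) 1)
      (≤-trans (h-lipschitz x y) (+-monoʳ-≤ (h x) (adj⇒d≤1 e)))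

    root-above : ∀ u → Above r u
    root-above u = trans (cong (_+ d r u) h-root) (≡-sym (h-spec u))

    above-refl : ∀ u → Above u u
    above-refl u = trans (cong (h u +_) (d-refl u)) (+-identityʳ _)

    above-adj : ∀ {p u} → adj G p u ≡ true → suc (h p) ≡ h u → Above p u
    above-adj {p} e eq = trans (cong (h p +_) (adj⇒d≡1 e)) (trans (+-comm _ 1) eq)

    above-trans : ∀ {z w u} → Above z w → Above w u → Above z u
    above-trans {z} {w} {u} zw wu = ≤-antisym
      (begin
        h z + d z u             ≤⟨ +-monoʳ-≤ (h z) (d-triangle z w u) ⟩
        h z + (d z w + d w u)   ≡⟨ +-assoc (h z) _ _ ⟨
        h z + d z w + d w u     ≡⟨ cong (_+ d w u) zw ⟩
        h w + d w u             ≡⟨ wu ⟩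
        h u                     ∎)
      (h-lipschitz z u)
      where open ≤-Reasoning

    above-flat : ∀ {z u} → Above z u → h u ≤ h z → z ≡ u
    above-flat {z} {u} zu le = d≡0⇒≡ (n≤0⇒n≡0 (+-cancelˡ-≤ (h z) _ _
      (subst₂ _≤_ (≡-sym zu) (≡-sym (+-identityʳ (h z))) le)))

    private
      gap : ∀ {z u} → Above z u → h z < h u → ∃ λ ℓ → d z u ≡ suc ℓ
      gap {z} {u} zu lt with d z u
      ... | zero = contradiction (subst (h z <_) (trans (≡-sym zu) (+-identityʳ _)) lt) (<-irrefl refl)
      ... | suc ℓ = ℓ , refl

    -- The last step of a geodesic from `z` to `u`; since heights change by at most one along an
    -- edge, both inequalities for `h p` are tight.
    above-parent : ∀ {z u} → Above z u → h z < h u →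
                   ∃ λ p → adj G u p ≡ true × suc (h p) ≡ h u × Above z p
    above-parent {z} {u} zu lt with gap zu lt
    ... | ℓ , eq with first-step (trans (d-sym u z) eq)
    ... | p , e , eq′ = p , e , trans (cong suc (≡-sym hp)) hu , trans (cong (h z +_) zp) hp
      where
      zp : d z p ≡ ℓ
      zp = trans (d-sym z p) eq′
      hu : suc (h z + ℓ) ≡ h u
      hu = trans (≡-sym (+-suc (h z) ℓ)) (trans (cong (h z +_) (≡-sym eq)) zu)
      hp : h z + ℓ ≡ h p
      hp = ≤-antisym (s≤s⁻¹ (subst (_≤ suc (h p)) (≡-sym hu) (h-adj (adj-sym e))))
                     (subst (λ x → h p ≤ h z + x) zp (h-lipschitz z p))

    above-child : ∀ {z u} → Above z u → h z < h u →
                  ∃ λ w → adj G z w ≡ true × h w ≡ suc (h z) × Above w u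
    above-child {z} {u} zu lt with gap zu lt
    ... | ℓ , eq with first-step eq
    ... | w , e , wu = w , e , hw , trans (cong₂ _+_ hw wu) hu
      where
      hu : suc (h z) + ℓ ≡ h u
      hu = trans (≡-sym (+-suc (h z) ℓ)) (trans (cong (h z +_) (≡-sym eq)) zu)
      hw : h w ≡ suc (h z)
      hw = ≤-antisym (h-adj e) (+-cancelʳ-≤ ℓ _ _
             (subst₂ _≤_ (≡-sym hu) (cong (h w +_) wu) (h-lipschitz w u)))

    parent : ∀ {u} → 0 < h u → ∃ λ p → adj G u p ≡ true × suc (h p) ≡ h u
    parent {u} 0<h with above-parent (root-above u) (subst (_< h u) (≡-sym h-root) 0<h)
    ... | p , e , hp , _ = p , e , hp

-- Pigeonhole for duplicate-free lists.

module _ {A : Set} where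

  unique-⊆-length : ∀ {xs ys : List A} → Unique xs → xs ⊆ ys → length xs ≤ length ys
  unique-⊆-length {[]} _ _ = z≤n
  unique-⊆-length {x ∷ xs} (x∉ ∷ un) sub with ∈-∃++ (sub (here refl))
  ... | as , bs , refl = begin
    suc (length xs)               ≤⟨ s≤s (unique-⊆-length un sub′) ⟩
    suc (length (as ++ bs))       ≡⟨ cong suc (length-++ as) ⟩
    suc (length as + length bs)   ≡⟨ +-suc (length as) (length bs) ⟨
    length as + length (x ∷ bs)   ≡⟨ length-++ as ⟨
    length (as ++ x ∷ bs)         ∎
    where
    open ≤-Reasoning
    sub′ : xs ⊆ as ++ bs
    sub′ {y} y∈ with ∈-++⁻ as (sub (there y∈))
    ... | inj₁ y∈as = ∈-++⁺ˡ y∈as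
    ... | inj₂ (here refl) = contradiction refl (All.lookup x∉ y∈)
    ... | inj₂ (there y∈bs) = ∈-++⁺ʳ as y∈bs

  -- A missing element could be added to `xs`, giving a duplicate-free list inside `ys` that is
  -- longer than `ys`.
  unique-⊆-full : DecidableEquality A → ∀ {xs ys : List A} →
                  Unique xs → xs ⊆ ys → length ys ≤ length xs → ys ⊆ xs
  unique-⊆-full _≟_ {xs} {ys} un sub le {y} y∈ with DecMembership._∈?_ _≟_ y xs
  ... | yes y∈xs = y∈xs
  ... | no y∉xs = contradiction (≤-trans (unique-⊆-length
          (All.¬Any⇒All¬ xs y∉xs ∷ un)
          λ { (here refl) → y∈ ; (there z∈) → sub z∈ }) le) (<-irrefl refl)

-- Edges of a tree as parent edges.

module _ {n : ℕ} where

  -- The normal form of an edge, smaller endpoint first, matching the pairs that `numEdges` counts.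
  unordered : Fin n → Fin n → Fin n × Fin n
  unordered x y = if toℕ x <ᵇ toℕ y then (x , y) else (y , x)

  unordered-injective : ∀ {x y x′ y′} → unordered x y ≡ unordered x′ y′ →
                        (x ≡ x′ × y ≡ y′) ⊎ (x ≡ y′ × y ≡ x′)
  unordered-injective {x} {y} {x′} {y′} eq
    with toℕ x <ᵇ toℕ y | toℕ x′ <ᵇ toℕ y′ | eq
  ... | true  | true  | refl = inj₁ (refl , refl)
  ... | true  | false | refl = inj₂ (refl , refl)
  ... | false | true  | refl = inj₂ (refl , refl)
  ... | false | false | refl = inj₁ (refl , refl)

  edgeList : Graph n → List (Fin n × Fin n)
  edgeList G = filterᵇ (λ p → adj G (proj₁ p) (proj₂ p) ∧ (toℕ (proj₁ p) <ᵇ toℕ (proj₂ p)))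
                       (cartesianProduct (allFin n) (allFin n))

  ∈-edgeList : ∀ (G : Graph n) {x y} → adj G x y ≡ true → unordered x y ∈ edgeList G
  ∈-edgeList G {x} {y} e with toℕ x <ᵇ toℕ y in eq
  ... | true = ∈-filter⁺ (T? ∘ _) (∈-cartesianProduct⁺ (∈-allFin x) (∈-allFin y))
        (Equivalence.from T-∧ (Equivalence.from T-≡ e , Equivalence.from T-≡ eq))
  ... | false = ∈-filter⁺ (T? ∘ _) (∈-cartesianProduct⁺ (∈-allFin y) (∈-allFin x))
        (Equivalence.from T-∧ (Equivalence.from T-≡ (trans (sym G y x) e) , y<x))
    where
    y<x : T (toℕ y <ᵇ toℕ x)
    y<x with <-cmp (toℕ x) (toℕ y)
    ... | tri< lt _ _ = contradiction (subst T eq (<⇒<ᵇ lt)) λ ()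
    ... | tri> _ _ gt = <⇒<ᵇ gt
    ... | tri≈ _ xy _ with Fin.toℕ-injective xy
    ... | refl = contradiction (trans (≡-sym e) (irrefl G x)) λ ()

-- The parents of the m − 1 other nodes give m − 1 distinct edges, so a tree has no other edge.
tree-parents : ∀ {m} (Tr : Graph m) → IsTree Tr → (ρ : Fin m) →
  Σ (Fin m → Fin m) λ par →
    par ρ ≡ ρ × (∀ {s t} → adj Tr s t ≡ true → t ≡ par s ⊎ s ≡ par t)
tree-parents {suc m} Tr (conn , size) ρ = par , par-root , par-edge
  where
  D : ∃ λ d → IsDistance Tr d
  D = distance-exists conn
  open Metric (proj₂ D)
  h : Fin (suc m) → ℕ
  h = proj₁ D ρ
  open Layers ρ h (λ _ → refl)

  nonroot : ∀ {t} → t ≢ ρ → 0 < h t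
  nonroot t≢ρ = n≢0⇒n>0 (λ eq → t≢ρ (≡-sym (h≡0⇒≡root eq)))

  par : Fin (suc m) → Fin (suc m)
  par t with t Fin.≟ ρ
  ... | yes _ = ρ
  ... | no t≢ρ = proj₁ (parent (nonroot t≢ρ))

  par-root : par ρ ≡ ρ
  par-root with ρ Fin.≟ ρ
  ... | yes _ = refl
  ... | no ρ≢ρ = contradiction refl ρ≢ρ

  par-spec : ∀ {t} → t ≢ ρ → adj Tr t (par t) ≡ true × suc (h (par t)) ≡ h t
  par-spec {t} t≢ρ with t Fin.≟ ρ
  ... | yes t≡ρ = contradiction t≡ρ t≢ρ
  ... | no t≢ρ′ = proj₂ (parent (nonroot t≢ρ′))

  node : Fin m → Fin (suc m)
  node = punchIn ρ

  node≢ρ : ∀ i → node i ≢ ρ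
  node≢ρ i = Fin.punchInᵢ≢i ρ i

  parentEdge : Fin m → Fin (suc m) × Fin (suc m)
  parentEdge i = unordered (node i) (par (node i))

  parentEdge-injective : ∀ {i j} → parentEdge i ≡ parentEdge j → i ≡ j
  parentEdge-injective {i} {j} eq with unordered-injective eq
  ... | inj₁ (e , _) = Fin.punchIn-injective ρ i j e
  -- Each node would be the parent of the other, hence strictly lower than itself.
  ... | inj₂ (e , e′) = contradiction
        (<-trans (lower i j e′) (lower j i (≡-sym e))) (<-irrefl refl)
    where
    lower : ∀ i j → par (node i) ≡ node j → h (node j) < h (node i)
    lower i j eq′ = ≤-reflexive (trans (cong (suc ∘ h) (≡-sym eq′)) (proj₂ (par-spec (node≢ρ i))))

  parentEdges : List (Fin (suc m) × Fin (suc m))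
  parentEdges = map parentEdge (allFin m)

  parentEdges-⊆ : parentEdges ⊆ edgeList Tr
  parentEdges-⊆ e∈ with ∈-map⁻ parentEdge e∈
  ... | i , _ , refl = ∈-edgeList Tr (proj₁ (par-spec (node≢ρ i)))

  par-edge : ∀ {s t} → adj Tr s t ≡ true → t ≡ par s ⊎ s ≡ par t
  par-edge e with ∈-map⁻ parentEdge (unique-⊆-full (≡-dec Fin._≟_ Fin._≟_)
      (Unique.map⁺ parentEdge-injective (Unique.allFin⁺ m)) parentEdges-⊆
      (≤-reflexive (trans size (≡-sym (trans (length-map parentEdge (allFin m)) (length-tabulate _)))))
      (∈-edgeList Tr e))
  ... | i , _ , eq with unordered-injective eq
  ... | inj₁ (refl , t≡) = inj₁ t≡
  ... | inj₂ (s≡ , refl) = inj₂ s≡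

-- Ascending chains in a rooted tree.

module _ {m : ℕ} (par : Fin m → Fin m) where

  data Chain (A : Fin m → Set) : Fin m → Fin m → Set where
    stop : ∀ {s} → A s → Chain A s s
    up   : ∀ {s c} → A s → Chain A (par s) c → Chain A s c

  chain-source : ∀ {A s c} → Chain A s c → A s
  chain-source (stop a) = a
  chain-source (up a _) = a

  chain-target : ∀ {A s c} → Chain A s c → A c
  chain-target (stop a) = a
  chain-target (up _ p) = chain-target p

  chain-snoc : ∀ {A s c} → Chain A s c → A (par c) → Chain A s (par c)
  chain-snoc (stop a) b = up a (stop b)
  chain-snoc (up a p) b = up a (chain-snoc p b)

  chain-from-root : ∀ {A ρ c} → par ρ ≡ ρ → Chain A ρ c → c ≡ ρ
  chain-from-root eq (stop _) = refl
  chain-from-root {A} {ρ} {c} eq (up a p) = go refl p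
    where
    go : ∀ {s} → par ρ ≡ s → Chain A s c → c ≡ ρ
    go refl (stop _) = eq
    go refl (up _ q) = go (trans (cong par (≡-sym eq)) refl) q

  -- Induction on the walk. A first node below the next one prolongs the chain. A first node above
  -- it either lies on the chain already or, if that chain is trivial, becomes the new meeting
  -- point.
  chain-meet : ∀ {Tr : Graph m} {A s t ℓ} →
    (∀ {s t} → adj Tr s t ≡ true → t ≡ par s ⊎ s ≡ par t) →
    WalkIn Tr A s t ℓ → ∃ λ c → Chain A s c × Chain A t c
  chain-meet _ (nil a) = _ , stop a , stop a
  chain-meet edge (cons a e p) with chain-meet edge p | edge e
  ... | c , wc , tc | inj₁ refl = c , up a wc , tc
  ... | c , stop b , tc | inj₂ refl = _ , stop a , chain-snoc tc a
  ... | c , up b sc , tc | inj₂ refl = c , sc , tc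

  -- Upward steps are forced, so a chain in `B` from `s` to the root visits every ancestor of `s`; a
  -- chain that continues past the root stays there.
  chain-through-root : ∀ {A B ρ s c} → par ρ ≡ ρ → Chain A s c → Chain B s ρ → B c
  chain-through-root eq (stop _) q = chain-source q
  chain-through-root {B = B} eq (up a p) (stop b) =
    subst B (≡-sym (chain-from-root eq (up a p))) b
  chain-through-root eq (up a p) (up b q) = chain-through-root eq p q

-- Connected sets in a tree decomposition.

module _ {n : ℕ} {G : Graph n} (TD : TreeDecomposition G) where

  Trace : (Fin n → Set) → Fin (m TD) → Set
  Trace A t = ∃ λ v → A v × T (bag TD t v)

  -- The bags of each vertex form a subtree, and a bag containing an edge of the walk joins the
  -- subtrees of its two ends.
  trace-walk : ∀ {A p q ℓ s t} → WalkIn G A p q ℓ → T (bag TD s p) → T (bag TD t q) →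
               ∃ λ ℓ′ → WalkIn (tree TD) (Trace A) s t ℓ′
  trace-walk {s = s} {t} (nil {u} a) sp tq with subtree TD u s t sp tq
  ... | ℓ′ , w = ℓ′ , walk-map (λ b → u , a , b) w
  trace-walk {s = s} (cons {u} {w} a e p) sp tq with edges TD u w e
  ... | x , xu , xw with subtree TD u s x sp xu | trace-walk p xw tq
  ... | i , W | j , W′ = i + j , walk-append (walk-map (λ b → u , a , b) W) W′

  -- Helly property of subtrees; rooting the tree at a bag of r makes two of them contain the root.
  common-bag : ∀ {A B C p q r i j l} →
    WalkIn G A p q i → WalkIn G B p r j → WalkIn G C q r l →
    ∃ λ t → Trace A t × Trace B t × Trace C t
  common-bag {p = p} {q} {r} P Q R
    with covers TD p | covers TD q | covers TD r
  ... | s , sp | s′ , sq | ρ , ρr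
    with tree-parents (tree TD) (isTree TD) ρ
  ... | par , par-root , par-edge
    with chain-meet par par-edge (proj₂ (trace-walk P sp sq))
       | chain-meet par par-edge (proj₂ (trace-walk Q sp ρr))
       | chain-meet par par-edge (proj₂ (trace-walk R sq ρr))
  ... | c , sc , s′c | c₁ , sc₁ , ρc₁ | c₂ , s′c₂ , ρc₂
    with chain-from-root par par-root ρc₁ | chain-from-root par par-root ρc₂
  -- `c` is an ancestor of both `s` and `s′`, so the chains from these up to `ρ`, in the traces of
  -- `B` and `C`, pass through it.
  ... | refl | refl = c , chain-target par sc ,
        chain-through-root par par-root sc sc₁ , chain-through-root par par-root s′c s′c₂

-- Treelength and distances within a layer.

module _ {n : ℕ} {G : Graph n} {d : Fin n → Fin n → ℕ} (D : IsDistance G d)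
         (r : Fin n) (h : Fin n → ℕ) (h-spec : ∀ v → h v ≡ d r v) where
  open Metric D
  open Layers r h h-spec

  geodesic-above : ∀ p → ∃ λ ℓ → WalkIn G (λ v → Above v p) p r ℓ
  geodesic-above p = h p , go (h p) (above-refl p) refl
    where
    go : ∀ i {v} → Above v p → h v ≡ i → WalkIn G (λ v → Above v p) v r i
    go zero {v} vp eq with h≡0⇒≡root eq
    ... | refl = nil vp
    go (suc i) {v} vp eq with parent (subst (0 <_) (≡-sym eq) (s≤s z≤n))
    ... | w , e , hw = cons vp e (go i (above-trans (above-adj (adj-sym e) hw) vp)
                                       (suc-injective (trans hw eq)))

  -- Take a bag meeting the walk and geodesics from p and q to r.  Its vertex a on the geodesic
  -- from p is within k of a vertex x with h x ≥ h p, hence h a ≥ h p − k and d a p ≤ k.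
  layer-component-diameter : ∀ {k j p q ℓ} → TreelengthAtMost k G →
    h p ≡ j → h q ≡ j → WalkIn G (λ v → j ≤ h v) p q ℓ → d p q ≤ k + (k + k)
  layer-component-diameter {k} {j} {p} {q} (TD , short) hp hq W
    with common-bag TD W (proj₂ (geodesic-above p)) (proj₂ (geodesic-above q))
  ... | t , (x , jx , tx) , (a , ap , ta) , (b , bq , tb) = begin
    d p q                    ≤⟨ d-triangle p a q ⟩
    d p a + d a q            ≤⟨ +-monoʳ-≤ (d p a) (d-triangle a b q) ⟩
    d p a + (d a b + d b q)  ≤⟨ +-mono-≤ (subst (_≤ k) (d-sym a p) (near a p hp ap ta))
                                 (+-mono-≤ (within ta tb) (near b q hq bq tb)) ⟩
    k + (k + k)              ∎
    where
    open ≤-Reasoning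
    within : ∀ {u v} → T (bag TD t u) → T (bag TD t v) → d u v ≤ k
    within {u} {v} tu tv with short t u v tu tv
    ... | ℓ , ℓ≤k , w = ≤-trans (d-minimal w) ℓ≤k
    near : ∀ a p → h p ≡ j → Above a p → T (bag TD t a) → d a p ≤ k
    near a p hp ap ta = +-cancelˡ-≤ (h a) _ _ (begin
      h a + d a p  ≡⟨ trans ap hp ⟩
      j            ≤⟨ jx ⟩
      h x          ≤⟨ h-lipschitz a x ⟩
      h a + d a x  ≤⟨ +-monoʳ-≤ (h a) (within ta tx) ⟩
      h a + k      ∎)

-- List lengths and balls in graphs of bounded degree.

length-filter-split : ∀ {A : Set} {P : A → Set} (P? : ∀ x → Dec (P x)) xs →
  length (filter P? xs) + length (filter (¬? ∘ P?) xs) ≡ length xs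
length-filter-split P? [] = refl
length-filter-split P? (x ∷ xs) with P? x
... | yes _ = cong suc (length-filter-split P? xs)
... | no _ = trans (+-suc _ _) (cong suc (length-filter-split P? xs))

length-concatMap-≤ : ∀ {A B : Set} (f : A → List B) {b} → (∀ x → length (f x) ≤ b) →
                     ∀ xs → length (concatMap f xs) ≤ length xs * b
length-concatMap-≤ f f≤b [] = z≤n
length-concatMap-≤ f {b} f≤b (x ∷ xs) = begin
  length (f x ++ concatMap f xs)             ≡⟨ length-++ (f x) ⟩
  length (f x) + length (concatMap f xs)     ≤⟨ +-mono-≤ (f≤b x) (length-concatMap-≤ f f≤b xs) ⟩
  b + length xs * b                          ∎
  where open ≤-Reasoning

module _ {n : ℕ} (G : Graph n) where

  neighbours : Fin n → List (Fin n)
  neighbours u = filterᵇ (adj G u) (allFin n)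

  -- Repetitions are harmless, as only an upper bound on the size is wanted. Keeping `u` at each
  -- step makes this the closed ball and gives the factor `suc Δ`.
  ball : ℕ → Fin n → List (Fin n)
  ball zero u = u ∷ []
  ball (suc R) u = concatMap (ball R) (u ∷ neighbours u)

  centre∈ball : ∀ R u → u ∈ ball R u
  centre∈ball zero u = here refl
  centre∈ball (suc R) u = ∈-concatMap⁺ (ball R) {xs = u ∷ neighbours u} (here (centre∈ball R u))

  walk⇒∈ball : ∀ {u v ℓ R} → Walk G u v ℓ → ℓ ≤ R → v ∈ ball R u
  walk⇒∈ball {R = R} (nil _) _ = centre∈ball R _
  walk⇒∈ball {u} {R = suc R} (cons {w = w} _ e p) (s≤s le) =
    ∈-concatMap⁺ (ball R) {xs = u ∷ neighbours u} (there (Any.map (λ { refl → walk⇒∈ball p le })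
      (∈-filter⁺ (T? ∘ adj G u) (∈-allFin w) (Equivalence.from T-≡ e))))

  length-ball : ∀ {Δ} → MaxDegreeAtMost Δ G → ∀ R u → length (ball R u) ≤ suc Δ ^ R
  length-ball deg zero u = ≤-refl
  length-ball {Δ} deg (suc R) u = ≤-trans
    (length-concatMap-≤ (ball R) (length-ball deg R) (u ∷ neighbours u))
    (*-monoˡ-≤ (suc Δ ^ R) (s≤s (deg u)))

-- Deterministic query programs and their cost.

data Query (n : ℕ) (A : Set) : Set where
  ret : A → Query n A
  ask : Fin n → Fin n → (ℕ → Query n A) → Query n A

infixl 1 _>>=_
_>>=_ : ∀ {n A B} → Query n A → (A → Query n B) → Query n B
ret a >>= f = f a
ask u v k >>= f = ask u v (λ x → k x >>= f)

module _ {n : ℕ} {A : Set} where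

  result : Query n A → (Fin n → Fin n → ℕ) → A
  result (ret a) d = a
  result (ask u v k) d = result (k (d u v)) d

  cost : Query n A → (Fin n → Fin n → ℕ) → ℕ
  cost (ret a) d = 0
  cost (ask u v k) d = suc (cost (k (d u v)) d)

  toAlg : Query n A → Alg n
  toAlg (ret a) = done
  toAlg (ask u v k) = query u v (toAlg ∘ k)

  expectedQueries-toAlg : ∀ q d → expectedQueries (toAlg q) d ≡ mkℚᵘ (ℤ.+ cost q d) 0
  expectedQueries-toAlg (ret a) d = refl
  expectedQueries-toAlg (ask u v k) d rewrite expectedQueries-toAlg (k (d u v)) d
    = cong (λ x → mkℚᵘ (ℤ.+ 1 ℤ.+ x) 0) (ℤ.*-identityʳ (ℤ.+ cost (k (d u v)) d))

  -- A Hoare-style postcondition together with a query budget, so that one derivation proves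
  -- correctness and complexity.
  record Runs (d : Fin n → Fin n → ℕ) (q : Query n A) (b : ℕ) (P : A → Set) : Set where
    constructor runs
    field
      cost-≤ : cost q d ≤ b
      holds  : P (result q d)
  open Runs public

-- A query program on oracle d′ gets the same answers as on d exactly when d′ satisfies
-- the constraints that the run on d accumulates, and then both runs have the same result.
reconstructs-toAlg : ∀ {n Δ k} {G : Graph n} {d P} (q : Query n (Fin n → Fin n → Bool)) →
  (∀ u v → adj G u v ≡ result q d u v) →
  (∀ G′ d′ → InClass Δ k G′ → IsDistance G′ d′ → P d′ → ∀ u v → adj G′ u v ≡ result q d′ u v) →
  ReconstructsFrom Δ k G d P (toAlg q)
reconstructs-toAlg (ret a) ok ok′ G′ d′ c D p u v = trans (ok u v) (≡-sym (ok′ G′ d′ c D p u v))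
reconstructs-toAlg {d = d} (ask u v k) ok ok′ = reconstructs-toAlg (k (d u v)) ok
  λ { G′ d′ c D (p , eq) x y →
      subst (λ a → adj G′ x y ≡ result (k a) d′ x y) eq (ok′ G′ d′ c D p x y) }

branch : ∀ {P A : Set} → Dec P → A → A → A
branch (yes _) a b = a
branch (no _) a b = b

module _ {n : ℕ} {d : Fin n → Fin n → ℕ} where

  runs-ret : ∀ {A b} {P : A → Set} {a} → P a → Runs d (ret a) b P
  runs-ret p = runs z≤n p

  runs-ask : ∀ {A b} {P : A → Set} {u v k} → Runs d (k (d u v)) b P → Runs d (ask u v k) (suc b) P
  runs-ask (runs c p) = runs (s≤s c) p

  cost->>= : ∀ {A B} (q : Query n A) (f : A → Query n B) →
             cost (q >>= f) d ≡ cost q d + cost (f (result q d)) d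
  cost->>= (ret a) f = refl
  cost->>= (ask u v k) f = cong suc (cost->>= (k (d u v)) f)

  result->>= : ∀ {A B} (q : Query n A) (f : A → Query n B) →
               result (q >>= f) d ≡ result (f (result q d)) d
  result->>= (ret a) f = refl
  result->>= (ask u v k) f = result->>= (k (d u v)) f

  runs->>= : ∀ {A B b c} {P : A → Set} {R : B → Set} {q f} → Runs d q b P →
             (∀ {a} → P a → Runs d (f a) c R) → Runs d (q >>= f) (b + c) R
  runs->>= {R = R} {q} {f} (runs c p) g = runs
    (subst (_≤ _) (≡-sym (cost->>= q f)) (+-mono-≤ c (cost-≤ (g p))))
    (subst R (≡-sym (result->>= q f)) (holds (g p)))

  runs-branch : ∀ {A b Q} {P : A → Set} (Q? : Dec Q) {x y} →
    (Q → Runs d x b P) → (¬ Q → Runs d y b P) → Runs d (branch Q? x y) b P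
  runs-branch (yes p) f g = f p
  runs-branch (no ¬p) f g = g ¬p

  runs-mono : ∀ {A b c} {P R : A → Set} {q} → b ≤ c → (∀ {a} → P a → R a) →
              Runs d q b P → Runs d q c R
  runs-mono b≤c f (runs c p) = runs (≤-trans c b≤c) (f p)

-- The reconstruction algorithm.

Within : ℕ → Maybe ℕ → Set
Within b (just a) = a ≤ b
Within b nothing = ⊥

within? : ∀ b x → Dec (Within b x)
within? b (just a) = a ≤? b
within? b nothing = no λ ()

isOne : Maybe ℕ → Bool
isOne (just 1) = true
isOne _ = false

-- `known` is a partial distance table; `above z v` records whether `z` is on a geodesic from the
-- root to `v`, and is meaningful only for inserted `v`.
record State (n : ℕ) : Set where
  field
    known : Fin n → Fin n → Maybe ℕ
    above : Fin n → Fin n → Bool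
open State

askAll : ∀ {n} → Fin n → List (Fin n) → Query n (Fin n → Maybe ℕ)
askAll u [] = ret λ _ → nothing
askAll u (w ∷ ws) = ask u w λ a →
  askAll u ws >>= λ row → ret λ y → branch (y Fin.≟ w) (just a) (row y)

-- b will be 3k, the bound on distances in a layer between vertices connected above it.
module Algorithm {n : ℕ} (r : Fin n) (h : Fin n → ℕ) (b : ℕ) where

  below : State n → Fin n → List (Fin n) → List (Fin n)
  below st z = filter (λ p → T? (above st z p))

  notBelow : State n → Fin n → List (Fin n) → List (Fin n)
  notBelow st z = filter (λ p → ¬? (T? (above st z p)))

  module Search (st : State n) (u : Fin n) where

    Heavy : Fin n → List (Fin n) → Fin n → Set
    Heavy z₀ ps x = h x < h u × T (above st z₀ x) × length ps < 2 * length (below st x ps)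

    heavy? : ∀ z₀ ps x → Dec (Heavy z₀ ps x)
    heavy? z₀ ps x = (h x <? h u) ×-dec T? (above st z₀ x)
                       ×-dec (length ps <? 2 * length (below st x ps))

    -- The pivot is a deepest heavy vertex: more than half of the candidates ps lie below it,
    -- but at most half of them below any of its children.
    key : Fin n → List (Fin n) → Fin n → ℕ
    key z₀ ps x = branch (heavy? z₀ ps x) (suc (h x)) 0

    pivot : Fin n → List (Fin n) → Fin n
    pivot z₀ ps = argmax (key z₀ ps) z₀ (allFin n)

    child? : ∀ z w → Dec (Within 1 (known st z w) × h w ≡ suc (h z))
    child? z w = within? 1 (known st z w) ×-dec (h w ≟ suc (h z))

    children : Fin n → List (Fin n)
    children z = filter (child? z) (allFin n)

    firstAbove : Fin n → List (Fin n) → Query n (Fin n)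
    -- A default, not reached as long as some listed vertex lies above `u`.
    firstAbove z [] = ret z
    firstAbove z (w ∷ ws) = ask w u λ a → branch (h w + a ≟ h u) (ret w) (firstAbove z ws)

    mutual

      -- The number bounds the remaining rounds, `z₀` is above `u`, and `ps` holds the possible
      -- parents of `u`. The pivot is an argument of `probe`, so that proofs can treat it as a
      -- variable.
      search : ℕ → Fin n → List (Fin n) → Query n (Fin n)
      search zero z₀ ps = ret z₀
      search (suc f) z₀ ps = probe f z₀ ps (pivot z₀ ps)

      probe : ℕ → Fin n → List (Fin n) → Fin n → Query n (Fin n)
      probe f z₀ ps z = ask z u λ a → branch (h z + a ≟ h u)
        (branch (suc (h z) ≟ h u) (ret z)
          (firstAbove z (children z) >>= λ w → search f w (below st w ps)))
        (search f z₀ (notBelow st z ps))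

    findParent : ℕ → Query n (Fin n)
    -- The root has no parent and stands in for it.
    findParent f = branch (h u ≟ 0) (ret u) (search f r (filter (λ p → suc (h p) ≟ h u) (allFin n)))

    -- Read off the table without queries. Including `u` records its distance to itself, since `u`
    -- is near itself.
    Candidate : Fin n → Fin n → Set
    Candidate p w = w ≡ u ⊎ ∃ λ p′ → Within b (known st p p′) × Within 1 (known st p′ w)

    candidate? : ∀ p w → Dec (Candidate p w)
    candidate? p w = (w Fin.≟ u) ⊎-dec
      Fin.any? (λ p′ → within? b (known st p p′) ×-dec within? 1 (known st p′ w))

    module _ (row : Fin n → Maybe ℕ) where

      NewAbove : Fin n → Set
      NewAbove z = z ≡ u ⊎ ∃ λ w → Within 1 (row w) × suc (h w) ≡ h u × T (above st z w)

      newAbove? : ∀ z → Dec (NewAbove z)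
      newAbove? z = (z Fin.≟ u) ⊎-dec
        Fin.any? (λ w → within? 1 (row w) ×-dec (suc (h w) ≟ h u) ×-dec T? (above st z w))

      update : State n
      known update x y = branch (x Fin.≟ u) (row y) (branch (y Fin.≟ u) (row x) (known st x y))
      above update z v = branch (v Fin.≟ u) ⌊ newAbove? z ⌋ (above st z v)

    step : ℕ → Query n (State n)
    step f = findParent f >>= λ p →
      askAll u (filter (candidate? p) (allFin n)) >>= λ row → ret (update row)

  process : ℕ → State n → List (Fin n) → Query n (State n)
  process f st [] = ret st
  process f st (u ∷ us) = Search.step st u f >>= λ st′ → process f st′ us

  empty : State n
  known empty x y = nothing
  above empty z v = false

-- Near pairs and the invariant of the table.

within-just : ∀ {b x a} → x ≡ just a → a ≤ b → Within b x
within-just refl le = le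

module _ {n : ℕ} (d : Fin n → Fin n → ℕ) where

  RowSpec : Fin n → List (Fin n) → (Fin n → Maybe ℕ) → Set
  RowSpec u ws row = (∀ {y a} → row y ≡ just a → a ≡ d u y) ×
                     (∀ {y} → y ∈ ws → row y ≡ just (d u y))

  runs-askAll : ∀ u ws → Runs d (askAll u ws) (length ws) (RowSpec u ws)
  runs-askAll u [] = runs-ret ((λ ()) , λ ())
  runs-askAll u (w ∷ ws) = runs-ask (runs-mono (≤-reflexive (+-identityʳ _)) (λ t → t)
    (runs->>= (runs-askAll u ws) λ {row} (snd , cmp) → runs-ret {b = 0} (sound row snd , complete row cmp)))
    where
    ext : (Fin n → Maybe ℕ) → Fin n → Maybe ℕ
    ext row y = branch (y Fin.≟ w) (just (d u w)) (row y)
    sound : ∀ row → (∀ {y a} → row y ≡ just a → a ≡ d u y) → ∀ {y a} → ext row y ≡ just a → a ≡ d u y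
    sound row snd {y} eq with y Fin.≟ w
    ... | yes refl = ≡-sym (just-injective eq)
    ... | no _ = snd eq
    complete : ∀ row → (∀ {y} → y ∈ ws → row y ≡ just (d u y)) →
               ∀ {y} → y ∈ w ∷ ws → ext row y ≡ just (d u y)
    complete row cmp {y} y∈ with y Fin.≟ w | y∈
    ... | yes refl | _ = refl
    ... | no y≢w | here y≡w = contradiction y≡w y≢w
    ... | no _ | there y∈ws = cmp y∈ws

module Correctness {n Δ k : ℕ} {G : Graph n} {d : Fin n → Fin n → ℕ}
  (D : IsDistance G d) (deg : MaxDegreeAtMost Δ G) (tl : TreelengthAtMost k G)
  (r : Fin n) (h : Fin n → ℕ) (h-spec : ∀ v → h v ≡ d r v) where

  open Metric D
  open Layers r h h-spec

  b : ℕ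
  b = k + (k + k)

  open Algorithm r h b

  Linked : ℕ → Fin n → Fin n → Set
  Linked i x y = ∃ λ ℓ → WalkIn G (λ v → i ≤ h v) x y ℓ

  -- The slack of one layer makes adjacent vertices near.
  Near : Fin n → Fin n → Set
  Near x y = ∃ λ i → Linked i x y × h x ≤ suc i × h y ≤ suc i

  near-sym : ∀ {x y} → Near x y → Near y x
  near-sym (i , (ℓ , p) , hx , hy) = i , (ℓ , walk-reverse p) , hy , hx

  near-refl : ∀ x → Near x x
  near-refl x = h x , (0 , nil ≤-refl) , n≤1+n _ , n≤1+n _

  near-adj : ∀ {x y} → adj G x y ≡ true → Near x y
  near-adj {x} {y} e with ≤-total (h x) (h y)
  ... | inj₁ le = h x , (1 , cons ≤-refl e (nil le)) , n≤1+n _ , h-adj e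
  ... | inj₂ le = h y , (1 , cons le e (nil ≤-refl)) , h-adj (adj-sym e) , n≤1+n _

  d≤1⇒adj : ∀ {x y} → d x y ≤ 1 → h x ≢ h y → adj G x y ≡ true
  d≤1⇒adj {x} {y} le hx≢hy with d x y in eq
  ... | zero = contradiction (cong h (d≡0⇒≡ eq)) hx≢hy
  d≤1⇒adj (s≤s z≤n) _ | suc zero = d≡1⇒adj eq

  length-filter-adj : ∀ {z} {P : Fin n → Set} (P? : ∀ x → Dec (P x)) →
    (∀ {w} → P w → adj G z w ≡ true) → length (filter P? (allFin n)) ≤ Δ
  length-filter-adj {z} P? f = ≤-trans
    (unique-⊆-length (Unique.filter⁺ P? (Unique.allFin⁺ n))
      λ w∈ → ∈-filter⁺ (T? ∘ adj G z) (∈-allFin _)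
               (Equivalence.from T-≡ (f (proj₂ (∈-filter⁻ P? {xs = allFin n} w∈)))))
    (deg z)

  length-filter-near : ∀ {u R} {P : Fin n → Set} (P? : ∀ x → Dec (P x)) →
    (∀ {w} → P w → d u w ≤ R) → length (filter P? (allFin n)) ≤ suc Δ ^ R
  length-filter-near {u} {R} P? f = ≤-trans
    (unique-⊆-length (Unique.filter⁺ P? (Unique.allFin⁺ n))
      λ {w} w∈ → walk⇒∈ball G (geodesic u w) (f (proj₂ (∈-filter⁻ P? {xs = allFin n} w∈))))
    (length-ball G deg R u)

  -- `S` is the set of inserted vertices. Every recorded distance is correct, but only near pairs
  -- are sure to be recorded.
  record Invariant (S : Fin n → Set) (st : State n) : Set where
    field
      sound          : ∀ {x y a} → known st x y ≡ just a → a ≡ d x y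
      complete       : ∀ {x y} → S x → S y → Near x y → known st x y ≡ just (d x y)
      above-sound    : ∀ {z v} → S v → T (above st z v) → Above z v
      above-complete : ∀ {z v} → S v → Above z v → T (above st z v)

    within-sound : ∀ {x y c} → Within c (known st x y) → d x y ≤ c
    within-sound {x} {y} w with known st x y in eq
    ... | just a = subst (_≤ _) (sound eq) w

  module Step {S : Fin n → Set} {st : State n} (inv : Invariant S st) (u : Fin n)
              (lower : ∀ {x} → h x < h u → S x) (upper : ∀ {x} → S x → h x ≤ h u) where
    open Invariant inv
    open Search st u

    -- Binary search for a parent of the new vertex.

    Target : Fin n → Set
    Target p = adj G u p ≡ true × suc (h p) ≡ h u

    target-S : ∀ {p} → suc (h p) ≡ h u → S p
    target-S eq = lower (≤-reflexive eq)

    target-above : ∀ {p} → Target p → Above p u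
    target-above (e , eq) = above-adj (adj-sym e) eq

    runs-firstAbove : ∀ z ws → (∃ λ w → w ∈ ws × Above w u) →
      Runs d (firstAbove z ws) (length ws) (λ w → w ∈ ws × Above w u)
    runs-firstAbove z [] (_ , () , _)
    runs-firstAbove z (w ∷ ws) (x , x∈ , xu) = runs-ask (runs-branch (h w + d w u ≟ h u)
      (λ wu → runs-ret (here refl , wu))
      (λ ¬wu → runs-mono ≤-refl (λ { (y∈ , yu) → there y∈ , yu })
        (runs-firstAbove z ws (x , rest x∈ ¬wu , xu))))
      where
      rest : x ∈ w ∷ ws → ¬ Above w u → x ∈ ws
      rest (here refl) ¬wu = contradiction xu ¬wu
      rest (there x∈′) _ = x∈′

    key-heavy : ∀ z₀ ps {x} → Heavy z₀ ps x → key z₀ ps x ≡ suc (h x)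
    key-heavy z₀ ps {x} hx with heavy? z₀ ps x
    ... | yes _ = refl
    ... | no ¬hx = contradiction hx ¬hx

    key-pos : ∀ z₀ ps x → 0 < key z₀ ps x → Heavy z₀ ps x
    key-pos z₀ ps x lt with heavy? z₀ ps x
    ... | yes hx = hx

    -- Exactly the heavy vertices have a positive key, even at height 0, so a heavy starting vertex
    -- forces a heavy maximum.
    pivot-heavy : ∀ z₀ ps → Heavy z₀ ps z₀ → Heavy z₀ ps (pivot z₀ ps)
    pivot-heavy z₀ ps hz₀ = key-pos z₀ ps (pivot z₀ ps) (≤-trans
      (subst (0 <_) (≡-sym (key-heavy z₀ ps hz₀)) (s≤s z≤n))
      (f[⊥]≤f[argmax] {f = key z₀ ps} z₀ (allFin n)))

    pivot-deepest : ∀ z₀ ps → Heavy z₀ ps (pivot z₀ ps) →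
                    ∀ {w} → h (pivot z₀ ps) < h w → ¬ Heavy z₀ ps w
    pivot-deepest z₀ ps hz {w} lt hw = contradiction
      (subst₂ _≤_ (key-heavy z₀ ps hw) (key-heavy z₀ ps hz)
        (All.lookup (f[xs]≤f[argmax] {f = key z₀ ps} z₀ (allFin n)) (∈-allFin w)))
      (<⇒≱ (s≤s lt))

    length-children : ∀ z → length (children z) ≤ Δ
    length-children z = length-filter-adj (child? z)
      λ { (w , eq) → d≤1⇒adj (within-sound w) λ eq′ → 1+n≢n (trans (≡-sym eq) (≡-sym eq′)) }

    private
      -- Discarding a strict majority leaves less than half; applied with `m` equal to `2 ^ f`.
      half-no : ∀ {a c p m} → a + c ≡ p → p < 2 * a → p < 2 * m → c < m
      half-no {a} {c} {m = m} refl lt lt′ = *-cancelˡ-< 2 c m (begin-strict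
        c + (c + 0)  ≡⟨ cong (c +_) (+-identityʳ c) ⟩
        c + c        <⟨ +-monoˡ-< c (+-cancelˡ-< a c a (subst (a + c <_) (cong (a +_) (+-identityʳ a)) lt)) ⟩
        a + c        <⟨ lt′ ⟩
        2 * m        ∎)
        where open ≤-Reasoning

    -- The loop invariant: `ps` lies in the layer before `u` and below `z₀`, and misses no parent of
    -- `u` below `z₀`.
    Range : Fin n → List (Fin n) → Set
    Range z₀ ps = (∀ {p} → p ∈ ps → suc (h p) ≡ h u × Above z₀ p) ×
                  (∀ {p} → Target p → Above z₀ p → p ∈ ps)

    -- A parent of `u` below `z` would put `z` above `u`, so no parent is lost.
    range-notBelow : ∀ {z₀ ps} z → ¬ Above z u → Range z₀ ps → Range z₀ (notBelow st z ps)
    range-notBelow {ps = ps} z ¬zu (layer , full) =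
      (λ p∈ → layer (proj₁ (∈-filter⁻ (λ p → ¬? (T? (above st z p))) {xs = ps} p∈))) ,
      (λ t z₀p → ∈-filter⁺ (λ p → ¬? (T? (above st z p))) (full t z₀p)
        λ zp → ¬zu (above-trans (above-sound (target-S (proj₂ t)) zp) (target-above t)))

    range-below : ∀ {z₀ ps w} → Above z₀ w → Range z₀ ps → Range w (below st w ps)
    range-below {ps = ps} {w} z₀w (layer , full) =
      (λ p∈ → let p∈ps , wp = ∈-filter⁻ (λ p → T? (above st w p)) {xs = ps} p∈
                  hp = proj₁ (layer p∈ps)
              in hp , above-sound (target-S hp) wp) ,
      (λ t wp → ∈-filter⁺ (λ p → T? (above st w p)) (full t (above-trans z₀w wp))
                  (above-complete (target-S (proj₂ t)) wp))

    range-nonempty : ∀ {z₀ ps} → Above z₀ u → h z₀ < h u → Range z₀ ps → 0 < length ps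
    range-nonempty z₀u z₀<u (_ , full) with above-parent z₀u z₀<u
    ... | p , e , hp , z₀p = ∈-length (full (e , hp) z₀p)

    -- All of `ps` lies below `z₀`, and `ps` contains a parent of `u`; the whole of a nonempty list
    -- is a strict majority.
    range-heavy : ∀ {z₀ ps} → Above z₀ u → h z₀ < h u → Range z₀ ps → Heavy z₀ ps z₀
    range-heavy {z₀} {ps} z₀u z₀<u range@(layer , _) =
      z₀<u , above-complete (lower z₀<u) (above-refl z₀) ,
      subst (λ qs → length ps < 2 * length qs)
        (≡-sym (filter-all (λ p → T? (above st z₀ p)) (All.tabulate λ p∈ →
          above-complete (target-S (proj₁ (layer p∈))) (proj₂ (layer p∈)))))
        (m<m+n (length ps) (subst (0 <_) (≡-sym (+-identityʳ _)) (range-nonempty z₀u z₀<u range)))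

    deeper : ∀ {z w} → h z < h u → suc (h z) ≢ h u → h w ≡ suc (h z) → h w < h u
    deeper z<u ¬eq hw = ≤∧≢⇒< (subst (_≤ h u) (≡-sym hw) z<u) (λ eq → ¬eq (trans (≡-sym hw) eq))

    children-complete : ∀ {z} → Above z u → h z < h u → suc (h z) ≢ h u →
                        ∃ λ w → w ∈ children z × Above w u
    children-complete {z} zu z<u ¬eq with above-child zu z<u
    ... | w , e , hw , wu = w ,
      ∈-filter⁺ (child? z) (∈-allFin w)
        (within-just (complete (lower z<u) (lower (deeper z<u ¬eq hw)) (near-adj e)) (adj⇒d≤1 e) , hw) , wu

    children-sound : ∀ {z w} → w ∈ children z → Above z w × h w ≡ suc (h z)
    children-sound {z} {w} w∈ with ∈-filter⁻ (child? z) {xs = allFin n} w∈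
    ... | _ , kn , hw = above-adj (d≤1⇒adj (within-sound kn)
            λ eq → 1+n≢n (trans (≡-sym hw) (≡-sym eq))) (≡-sym hw) , hw

    mutual

      -- Each round asks about the pivot and at most `Δ` children, and halves the bound on `ps`.
      runs-search : ∀ f z₀ ps → Above z₀ u → h z₀ < h u → Range z₀ ps →
        length ps < 2 ^ f → Runs d (search f z₀ ps) (f * suc Δ) Target
      runs-search zero z₀ ps z₀u z₀<u range size =
        -- The bound `2 ^ 0` would make `ps` empty, yet some parent of `u` is in it.
        contradiction (range-nonempty z₀u z₀<u range) (<⇒≱ size)
      runs-search (suc f) z₀ ps z₀u z₀<u range size =
        runs-probe f z₀ ps (pivot z₀ ps) z₀u z₀<u range size hz (pivot-deepest z₀ ps hz)
        where
        hz : Heavy z₀ ps (pivot z₀ ps)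
        hz = pivot-heavy z₀ ps (range-heavy z₀u z₀<u range)

      runs-probe : ∀ f z₀ ps z → Above z₀ u → h z₀ < h u → Range z₀ ps → length ps < 2 ^ suc f →
        Heavy z₀ ps z → (∀ {w} → h z < h w → ¬ Heavy z₀ ps w) →
        Runs d (probe f z₀ ps z) (suc f * suc Δ) Target
      runs-probe f z₀ ps z z₀u z₀<u range size (z<u , tz₀z , half) deepest =
        runs-ask (runs-branch (h z + d z u ≟ h u) hit miss)
        where
        z₀z : Above z₀ z
        z₀z = above-sound (lower z<u) tz₀z

        miss : ¬ Above z u → Runs d (search f z₀ (notBelow st z ps)) (Δ + f * suc Δ) Target
        miss ¬zu = runs-mono (m≤n+m _ Δ) (λ t → t)
          (runs-search f z₀ (notBelow st z ps) z₀u z₀<u (range-notBelow z ¬zu range)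
            (half-no (length-filter-split (λ p → T? (above st z p)) ps) half size))

        descend : ∀ {w} → suc (h z) ≢ h u → Above z w → h w ≡ suc (h z) → Above w u →
                  Runs d (search f w (below st w ps)) (f * suc Δ) Target
        descend {w} ¬eq zw hw wu = runs-search f w (below st w ps) wu w<u
          (range-below z₀w range)
          -- The child `w` is deeper than the pivot, hence not heavy: at most half of `ps` lies
          -- below it.
          (*-cancelˡ-< 2 _ _ (≤-<-trans (≮⇒≥ λ lt → deepest
              (≤-reflexive (≡-sym hw)) (w<u , above-complete (lower w<u) z₀w , lt)) size))
          where
          w<u : h w < h u
          w<u = deeper z<u ¬eq hw
          z₀w : Above z₀ w
          z₀w = above-trans z₀z zw

        hit : Above z u → Runs d (branch (suc (h z) ≟ h u) (ret z)
                (firstAbove z (children z) >>= λ w → search f w (below st w ps))) (Δ + f * suc Δ) Target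
        hit zu = runs-branch (suc (h z) ≟ h u)
          -- A pivot above `u` in the preceding layer is at distance 1, so it is itself a parent.
          (λ eq → runs-ret (d≡1⇒adj (trans (d-sym u z) (+-cancelˡ-≡ (h z) _ _
              (trans zu (trans (≡-sym eq) (≡-sym (+-comm (h z) 1)))))) , eq))
          λ ¬eq → runs->>= (runs-mono (length-children z) (λ t → t)
              (runs-firstAbove z (children z) (children-complete zu z<u ¬eq)))
            λ { (w∈ , wu) → descend ¬eq (proj₁ (children-sound w∈)) (proj₂ (children-sound w∈)) wu }

    -- Candidates and the updated table.

    IsParent : Fin n → Set
    IsParent p = (h u ≡ 0 × p ≡ u) ⊎ Target p

    parent-close : ∀ {p} → IsParent p → d u p ≤ 1
    parent-close (inj₁ (_ , refl)) = ≤-trans (≤-reflexive (d-refl u)) z≤n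
    parent-close (inj₂ (e , _)) = adj⇒d≤1 e

    runs-findParent : ∀ f → n < 2 ^ f → Runs d (findParent f) (f * suc Δ) IsParent
    runs-findParent f size = runs-branch (h u ≟ 0)
      (λ eq → runs-ret (inj₁ (eq , refl)))
      λ ¬eq → runs-mono ≤-refl inj₂ (runs-search f r _ (root-above u)
        (subst (_< h u) (≡-sym h-root) (n≢0⇒n>0 ¬eq))
        ((λ p∈ → proj₂ (∈-filter⁻ (λ p → suc (h p) ≟ h u) {xs = allFin n} p∈) , root-above _) ,
         (λ t _ → ∈-filter⁺ (λ p → suc (h p) ≟ h u) (∈-allFin _) (proj₂ t)))
        (≤-<-trans (≤-trans (length-filter (λ p → suc (h p) ≟ h u) (allFin n))
          (≤-reflexive (length-tabulate _))) size))

    candidate-close : ∀ {p w} → IsParent p → Candidate p w → d u w ≤ 1 + (b + 1)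
    candidate-close _ (inj₁ refl) = ≤-trans (≤-reflexive (d-refl u)) z≤n
    candidate-close {p} {w} par (inj₂ (p′ , pp′ , p′w)) = ≤-trans (d-triangle u p w)
      (+-mono-≤ (parent-close par) (≤-trans (d-triangle p p′ w)
        (+-mono-≤ (within-sound pp′) (within-sound p′w))))

    -- The walk witnessing nearness stays at height at least `h p` and can be started at `p`. Its
    -- end `y` is in the layer of `p` or one further; take `p′` to be `y` or a parent of `y`. The
    -- layer diameter bound then applies to `p` and `p′`.
    candidate-complete : ∀ {p y} → IsParent p → S y ⊎ y ≡ u → Near u y → Candidate p y
    candidate-complete _ (inj₂ y≡u) _ = inj₁ y≡u
    candidate-complete {y = y} (inj₁ (hu≡0 , _)) (inj₁ sy) _ = inj₁
      -- When `u` is the root, any inserted vertex also has height 0 and equals `u`.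
      (trans (≡-sym (h≡0⇒≡root (n≤0⇒n≡0 (subst (h y ≤_) hu≡0 (upper sy))))) (h≡0⇒≡root hu≡0))
    candidate-complete {p} {y} (inj₂ (e , hp)) (inj₁ sy) (i , (ℓ , W) , hu≤ , _) =
      inj₂ (via (≤-antisym-split hp≤hy))
      where
      W′ : WalkIn G (λ v → h p ≤ h v) u y ℓ
      W′ = walk-map (≤-trans (s≤s⁻¹ (subst (_≤ suc i) (≡-sym hp) hu≤))) W

      hp≤hy : h p ≤ h y
      hp≤hy = walk-target W′

      ≤-antisym-split : h p ≤ h y → h p ≡ h y ⊎ suc (h p) ≡ h y
      ≤-antisym-split le with m≤n⇒m<n∨m≡n le
      ... | inj₁ lt = inj₂ (≤-antisym lt (subst (h y ≤_) (≡-sym hp) (upper sy)))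
      ... | inj₂ eq = inj₁ eq

      close : ∀ {p′ ℓ} → S p′ → h p ≡ h p′ → WalkIn G (λ v → h p ≤ h v) p p′ ℓ →
              Within b (known st p p′)
      close sp′ eq V = within-just
        (complete (target-S hp) sp′ (h p , (_ , V) , n≤1+n _ , ≤-trans (≤-reflexive (≡-sym eq)) (n≤1+n _)))
        (layer-component-diameter D r h h-spec tl refl (≡-sym eq) V)

      p⇝y : WalkIn G (λ v → h p ≤ h v) p y (suc ℓ)
      p⇝y = cons ≤-refl (adj-sym e) W′

      via : h p ≡ h y ⊎ suc (h p) ≡ h y →
            ∃ λ p′ → Within b (known st p p′) × Within 1 (known st p′ y)
      via (inj₁ eq) = y , close sy eq p⇝y ,
        within-just (complete sy sy (near-refl y)) (≤-trans (≤-reflexive (d-refl y)) z≤n)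
      via (inj₂ eq) with parent {y} (subst (0 <_) eq (s≤s z≤n))
      ... | p′ , e′ , hp′ = p′ ,
          close sp′ eq′ (walk-append p⇝y (cons hp≤hy e′ (nil (≤-reflexive eq′)))) ,
          within-just (complete sp′ sy (near-adj (adj-sym e′))) (adj⇒d≤1 (adj-sym e′))
        where
        eq′ : h p ≡ h p′
        eq′ = suc-injective (trans eq (≡-sym hp′))
        sp′ : S p′
        sp′ = target-S (trans (cong suc (≡-sym eq′)) hp)

    update-invariant : ∀ {p row} {S′ : Fin n → Set} → IsParent p →
      RowSpec d u (filter (candidate? p) (allFin n)) row →
      (∀ {x} → S′ x → S x ⊎ x ≡ u) → Invariant S′ (update row)
    update-invariant {p} {row} {S′} par (row-sound , row-complete) split = record
      { sound = snd ; complete = cmp ; above-sound = asnd ; above-complete = acmp }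
      where
      row-near : ∀ {y} → S y ⊎ y ≡ u → Near u y → row y ≡ just (d u y)
      row-near sy near = row-complete (∈-filter⁺ (candidate? p) (∈-allFin _)
                           (candidate-complete par sy near))

      snd : ∀ {x y a} → known (update row) x y ≡ just a → a ≡ d x y
      snd {x} {y} eq with x Fin.≟ u | y Fin.≟ u
      ... | yes refl | _ = row-sound eq
      ... | no _ | yes refl = trans (row-sound eq) (d-sym y x)
      ... | no _ | no _ = sound eq

      old : ∀ {x} → S′ x → x ≢ u → S x
      old sx x≢u with split sx
      ... | inj₁ s = s
      ... | inj₂ x≡u = contradiction x≡u x≢u

      cmp : ∀ {x y} → S′ x → S′ y → Near x y → known (update row) x y ≡ just (d x y)
      cmp {x} {y} sx sy near with x Fin.≟ u | y Fin.≟ u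
      ... | yes refl | _ = row-near (split sy) near
      ... | no _ | yes refl = trans (row-near (split sx) (near-sym near)) (cong just (d-sym y x))
      ... | no x≢u | no y≢u = complete (old sx x≢u) (old sy y≢u) near

      row-within-sound : ∀ {w} → Within 1 (row w) → d u w ≤ 1
      row-within-sound {w} wi with row w in eq
      ... | just a = subst (_≤ 1) (row-sound eq) wi

      asnd : ∀ {z v} → S′ v → T (above (update row) z v) → Above z v
      asnd {z} {v} sv t with v Fin.≟ u
      ... | no v≢u = above-sound (old sv v≢u) t
      ... | yes refl with toWitness {a? = newAbove? row z} t
      ... | inj₁ refl = above-refl z
      ... | inj₂ (w , rw , hw , zw) = above-trans (above-sound (target-S hw) zw)
            (target-above (d≤1⇒adj (row-within-sound rw) (λ eq → 1+n≢n (trans hw eq)) , hw))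

      acmp : ∀ {z v} → S′ v → Above z v → T (above (update row) z v)
      acmp {z} {v} sv zv with v Fin.≟ u
      ... | no v≢u = above-complete (old sv v≢u) zv
      ... | yes refl = fromWitness {a? = newAbove? row z} new
        where
        new : NewAbove row z
        new with h z <? h v
        -- Either the geodesic from `z` is trivial or it enters `v` through a parent, which is in
        -- the table already.
        ... | no z≮v = inj₁ (above-flat zv (≮⇒≥ z≮v))
        ... | yes z<v with above-parent zv z<v
        ... | w , e , hw , zw = inj₂ (w ,
              within-just (row-near (inj₁ (target-S hw)) (near-adj e)) (adj⇒d≤1 e) , hw ,
              above-complete (target-S hw) zw)

  -- Insertion of all vertices.

  stepCost : ℕ → ℕ
  stepCost f = f * suc Δ + suc Δ ^ (1 + (b + 1))

  runs-step : ∀ {S S′ : Fin n → Set} {st f} u → n < 2 ^ f → Invariant S st →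
    (∀ {x} → h x < h u → S x) → (∀ {x} → S x → h x ≤ h u) → (∀ {x} → S′ x → S x ⊎ x ≡ u) →
    Runs d (Search.step st u f) (stepCost f) (Invariant S′)
  runs-step {st = st} {f} u size inv lower upper split =
    runs->>= (runs-findParent f size) λ {p} par →
      runs-mono (≤-trans (≤-reflexive (+-identityʳ _))
                  (length-filter-near (candidate? p) (candidate-close par))) (λ t → t)
        (runs->>= (runs-askAll d u (filter (candidate? p) (allFin n))) λ rowSpec →
          runs-ret {b = 0} (update-invariant par rowSpec split))
    where
    open Step inv u lower upper
    open Search st u

  -- The inserted set is the complement of the remaining list. Sortedness provides both height
  -- conditions on the next vertex.
  runs-process : ∀ {f st} us → n < 2 ^ f → AllPairs (λ x y → h x ≤ h y) us →
    Invariant (_∉ us) st → (∀ {x y} → x ∉ us → y ∈ us → h x ≤ h y) →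
    Runs d (process f st us) (length us * stepCost f) (Invariant (_∉ []))
  runs-process [] _ _ inv _ = runs-ret inv
  runs-process (u ∷ us) size (u≤ ∷ sorted) inv upper =
    runs->>= (runs-step u size inv lower (λ sx → upper sx (here refl)) split)
      λ inv′ → runs-process us size sorted inv′ upper′
    where
    lower : ∀ {x} → h x < h u → x ∉ u ∷ us
    lower lt (here refl) = <-irrefl refl lt
    lower lt (there x∈) = <⇒≱ lt (All.lookup u≤ x∈)
    split : ∀ {x} → x ∉ us → x ∉ u ∷ us ⊎ x ≡ u
    split {x} x∉ with x Fin.≟ u
    ... | yes x≡u = inj₂ x≡u
    ... | no x≢u = inj₁ λ { (here x≡u) → x≢u x≡u ; (there x∈) → x∉ x∈ }
    upper′ : ∀ {x y} → x ∉ us → y ∈ us → h x ≤ h y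
    upper′ x∉ y∈ with split x∉
    ... | inj₁ x∉′ = upper x∉′ (there y∈)
    ... | inj₂ refl = All.lookup u≤ y∈

  empty-invariant : ∀ {S : Fin n → Set} → (∀ x → ¬ S x) → Invariant S empty
  empty-invariant ¬S = record
    { sound = λ () ; complete = λ sx → contradiction sx (¬S _)
    ; above-sound = λ _ () ; above-complete = λ sv → contradiction sv (¬S _) }

  -- Adjacent pairs are near, hence recorded with distance 1; soundness excludes any other entry 1.
  output-correct : ∀ {st} → Invariant (_∉ []) st → ∀ x y → adj G x y ≡ isOne (known st x y)
  output-correct {st} inv x y with adj G x y in e
  ... | true = ≡-sym (cong isOne (trans (complete (λ ()) (λ ()) (near-adj e)) (cong just (adj⇒d≡1 e))))
    where open Invariant inv
  ... | false with known st x y in eq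
  ... | nothing = refl
  ... | just 0 = refl
  ... | just (suc (suc _)) = refl
  ... | just 1 = trans (≡-sym e) (d≡1⇒adj (≡-sym (Invariant.sound inv eq)))

-- The full program and its query count.

byHeight : ∀ {n} → (Fin n → ℕ) → DecTotalOrder _ _ _
byHeight h = On.decTotalOrder ≤-decTotalOrder h

levelOrder : ∀ {n} → (Fin n → ℕ) → List (Fin n)
levelOrder {n} h = Sort.sort (byHeight h) (allFin n)

module _ {n : ℕ} (k : ℕ) (r : Fin n) where

  explore : (Fin n → ℕ) → Query n (Fin n → Fin n → Bool)
  explore h = process (suc ⌈log₂ n ⌉) empty (levelOrder h) >>= λ st →
    ret λ x y → isOne (known st x y)
    where open Algorithm r h (k + (k + k))

  reconstruct : Query n (Fin n → Fin n → Bool)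
  reconstruct = askAll r (allFin n) >>= λ row → explore (fromMaybe 0 ∘ row)

-- The extra round comes from the strict inequality that the search requires.
n<2^1+⌈log₂n⌉ : ∀ n → n < 2 ^ suc ⌈log₂ n ⌉
n<2^1+⌈log₂n⌉ n = ≰⇒> λ le → <-irrefl refl
  (subst (_≤ ⌈log₂ n ⌉) (⌈log₂2^n⌉≡n (suc ⌈log₂ n ⌉)) (⌈log₂⌉-mono-≤ le))

ballBound : ℕ → ℕ → ℕ
ballBound Δ k = suc Δ ^ (1 + (k + (k + k) + 1))

module _ {n Δ k : ℕ} {G : Graph n} {d : Fin n → Fin n → ℕ}
         (C : InClass Δ k G) (D : IsDistance G d) (r : Fin n) where

  runs-explore : ∀ h → (∀ v → h v ≡ d r v) →
    Runs d (explore k r h) (n * (suc ⌈log₂ n ⌉ * suc Δ + ballBound Δ k))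
      (λ out → ∀ x y → adj G x y ≡ out x y)
  runs-explore h h-spec = runs-mono
      (≤-reflexive (trans (+-identityʳ _) (cong (_* stepCost (suc ⌈log₂ n ⌉))
        (trans (↭-length perm) (length-tabulate {n = n} (λ i → i)))))) (λ t → t)
      (runs->>= (runs-process (levelOrder h) (n<2^1+⌈log₂n⌉ n)
          (Sorted⇒AllPairs (DecTotalOrder.totalOrder (byHeight h))
            (Sort.sort-↗ (byHeight h) (allFin n)))
          (empty-invariant λ x x∉ → x∉ (all∈ x)) (λ {x} x∉ _ → contradiction (all∈ x) x∉))
        λ inv → runs-ret {b = 0} (output-correct inv))
    where
    open Correctness D (proj₁ (proj₂ C)) (proj₂ (proj₂ C)) r h h-spec
    perm : levelOrder h ↭ allFin n
    perm = Sort.sort-↭ (byHeight h) (allFin n)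
    all∈ : ∀ x → x ∈ levelOrder h
    all∈ x = ∈-resp-↭ (↭-sym perm) (∈-allFin x)

  runs-reconstruct : Runs d (reconstruct k r) (n + n * (suc ⌈log₂ n ⌉ * suc Δ + ballBound Δ k))
    (λ out → ∀ x y → adj G x y ≡ out x y)
  runs-reconstruct = runs->>=
    (runs-mono (≤-reflexive (length-tabulate {n = n} (λ i → i))) (λ t → t) (runs-askAll d r (allFin n)))
    λ {row} (_ , row-complete) →
      runs-explore (fromMaybe 0 ∘ row) (λ v → cong (fromMaybe 0) (row-complete (∈-allFin v)))

-- The count is linear in `L`; with `1 ≤ L`, both 1 and `L` are absorbed into `L ^ 2`.
cost-bound : ∀ Δ B n L → 1 ≤ L →
  n + n * (suc L * suc Δ + B) ≤ (1 + (2 * suc Δ + B)) * n * (L ^ 2)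
cost-bound Δ B n L 1≤L = begin
  n + n * (suc L * suc Δ + B)              ≡⟨ *-suc n _ ⟨
  n * (1 + (suc L * suc Δ + B))            ≤⟨ *-monoʳ-≤ n (begin
    1 + (suc L * suc Δ + B)                  ≤⟨ +-mono-≤ 1≤L² (+-mono-≤ left right) ⟩
    L ^ 2 + (2 * suc Δ * L ^ 2 + B * L ^ 2)  ≡⟨ cong (L ^ 2 +_) (*-distribʳ-+ (L ^ 2) (2 * suc Δ) B) ⟨
    (1 + (2 * suc Δ + B)) * L ^ 2            ∎) ⟩
  n * ((1 + (2 * suc Δ + B)) * L ^ 2)      ≡⟨ *-assoc n _ _ ⟨
  n * (1 + (2 * suc Δ + B)) * L ^ 2        ≡⟨ cong (_* L ^ 2) (*-comm n _) ⟩
  (1 + (2 * suc Δ + B)) * n * L ^ 2        ∎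
  where
  open ≤-Reasoning
  1≤L² : 1 ≤ L ^ 2
  1≤L² = ^-monoˡ-≤ 2 1≤L
  L≤L² : L ≤ L ^ 2
  L≤L² = subst₂ _≤_ (*-identityʳ L) (cong (L *_) (≡-sym (*-identityʳ L))) (*-monoʳ-≤ L 1≤L)
  left : suc L * suc Δ ≤ 2 * suc Δ * L ^ 2
  left = begin
    suc L * suc Δ            ≤⟨ *-monoˡ-≤ (suc Δ) (+-mono-≤ 1≤L² L≤L²) ⟩
    (L ^ 2 + L ^ 2) * suc Δ  ≡⟨ cong (λ x → (L ^ 2 + x) * suc Δ) (+-identityʳ (L ^ 2)) ⟨
    2 * L ^ 2 * suc Δ        ≡⟨ *-assoc 2 (L ^ 2) (suc Δ) ⟩
    2 * (L ^ 2 * suc Δ)      ≡⟨ cong (2 *_) (*-comm (L ^ 2) (suc Δ)) ⟩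
    2 * (suc Δ * L ^ 2)      ≡⟨ *-assoc 2 (suc Δ) (L ^ 2) ⟨
    2 * suc Δ * L ^ 2        ∎
  right : B ≤ B * L ^ 2
  right = subst (_≤ B * L ^ 2) (*-identityʳ B) (*-monoʳ-≤ B 1≤L²)

factor : ℕ → ℕ → ℕ
factor Δ k = 1 + (2 * suc Δ + ballBound Δ k)

-- On fewer than two vertices ⌈log₂ n⌉ vanishes, so no query at all may be made.
program : ℕ → (n : ℕ) → Query n (Fin n → Fin n → Bool)
program k (suc (suc n)) = reconstruct k zero
program k _ = ret λ _ _ → false

runs-program : ∀ {Δ k} n {G : Graph n} {d} → InClass Δ k G → IsDistance G d →
  Runs d (program k n) (factor Δ k * n * (⌈log₂ n ⌉ ^ 2)) (λ out → ∀ x y → adj G x y ≡ out x y)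
runs-program 0 _ _ = runs-ret λ ()
runs-program 1 {G} _ _ = runs-ret λ { zero zero → irrefl G zero }
runs-program {Δ} {k} n@(suc (suc n′)) c D = runs-mono
  (cost-bound Δ (ballBound Δ k) n ⌈log₂ n ⌉ (⌈log₂⌉-mono-≤ {2} {n} (s≤s (s≤s z≤n))))
  (λ t → t) (runs-reconstruct c D zero)

open import Data.Integer using (+_)

theorem1 : (Δ k : ℕ) →
    Σ ((n : ℕ) → Alg n) λ alg →
    Σ ℕ λ c →
    ∀ (n : ℕ) (G : Graph n) (d : Fin n → Fin n → ℕ) →
    InClass Δ k G → IsDistance G d →
    Reconstructs Δ k G d (alg n) ×
    expectedQueries (alg n) d ≤ℚ mkℚᵘ (+ (c * n * (⌈log₂ n ⌉ ^ 2))) 0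
theorem1 Δ k = (λ n → toAlg (program k n)) , factor Δ k , λ n G d c D →
  reconstructs-toAlg (program k n) (holds (runs-program n c D))
    -- Correctness on every graph of the class: an oracle giving the same answers yields the same
    -- output, hence the same edges.
    (λ G′ d′ c′ D′ _ → holds (runs-program n c′ D′)) ,
  subst (_≤ℚ _) (≡-sym (expectedQueries-toAlg (program k n) d))
    (*≤* (ℤ.*-monoʳ-≤-nonNeg (+ 1) (ℤ.+≤+ (cost-≤ (runs-program n c D)))))
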